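{- Let $n,m\ge 5$ be integers with $m\equiv 0\pmod 4$ and $n\equiv 1\pmod 4$. Then $\gamma_p(C_n\times C_m)\le\frac{(n+1)m}{4}$.
   Context: All graphs are finite, simple and undirected. $C_n$ denotes the cycle of order $n$ and $G\times H$ the Cartesian product of graphs. For a graph $G$ without isolated vertices, a set $D\subseteq V(G)$ is a paired dominating set if every vertex outside $D$ has a neighbour in $D$ and the induced subgraph $G[D]$ has a perfect matching; $\gamma_p(G)$ is the minimum size of a paired dominating set. -}

module Defs where

open import Data.Fin.Base using (Fin; toℕ; remQuot)
open import Data.Fin.Subset using (Subset; _∈_; _∉_; ∣_∣)
open import Data.Nat.Base using (ℕ; suc; _*_; _≤_; s≤s)
open import Data.Nat.Properties using (1+n≢n)
open import Data.Product using (Σ-syntax; ∃-syntax; ∃!; _×_; _,_; proj₁)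
open import Data.Sum.Base using (_⊎_; inj₁; inj₂; swap)
open import Function.Base using (_on_)
open import Level using (0ℓ)
open import Relation.Binary.Core using (Rel; _⇒_)
open import Relation.Binary.Definitions using (Symmetric; Irreflexive)
open import Relation.Binary.PropositionalEquality using (_≡_; refl; sym; trans; cong)
open import Relation.Nullary.Negation using (¬_)

private
  variable
    V W : Set
    k l : ℕ

record Graph (V : Set) : Set₁ where
  field
    Adj        : Rel V 0ℓ
    adj-sym    : Symmetric Adj
    adj-irrefl : Irreflexive _≡_ Adj

open Graph public

comap : (W → V) → Graph V → Graph W
comap f G .Adj                   = Adj G on f
comap f G .adj-sym               = adj-sym G
comap f G .adj-irrefl refl       = adj-irrefl G refl

-- The subgraph G[D]; its vertices are the elements of D.
induced : Graph (Fin k) → (D : Subset k) → Graph (∃[ v ] v ∈ D)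
induced G D = comap proj₁ G

cartesian : Graph V → Graph W → Graph (V × W)
cartesian G H .Adj (a , b) (c , d) = (a ≡ c × Adj H b d) ⊎ (Adj G a c × b ≡ d)
cartesian G H .adj-sym (inj₁ (refl , h)) = inj₁ (refl , adj-sym H h)
cartesian G H .adj-sym (inj₂ (g , refl)) = inj₂ (adj-sym G g , refl)
cartesian G H .adj-irrefl refl (inj₁ (_ , h)) = adj-irrefl H refl h
cartesian G H .adj-irrefl refl (inj₂ (g , _)) = adj-irrefl G refl g

-- The Cartesian product with its vertices relabelled by Fin (k * l) along the
-- bijection remQuot, so that Data.Fin.Subset applies to its vertex sets.
infixl 7 _□_
_□_ : Graph (Fin k) → Graph (Fin l) → Graph (Fin (k * l))
_□_ {l = l} G H = comap (remQuot l) (cartesian G H)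

-- Cyclic successor: j = i + 1, or i is the last vertex and j is the first.
Next : Rel (Fin k) 0ℓ
Next {k} i j = toℕ j ≡ suc (toℕ i) ⊎ (suc (toℕ i) ≡ k × toℕ j ≡ 0)

cycle : (n : ℕ) → 3 ≤ n → Graph (Fin n)
cycle n 3≤n .Adj i j = Next i j ⊎ Next j i
cycle n 3≤n .adj-sym = swap
cycle n 3≤n .adj-irrefl {i} refl = λ { (inj₁ p) → next-irrefl 3≤n p ; (inj₂ p) → next-irrefl 3≤n p }
  where
  next-irrefl : 3 ≤ n → ¬ Next i i
  next-irrefl _ (inj₁ i≡1+i) = 1+n≢n (sym i≡1+i)
  next-irrefl 3≤n (inj₂ (1+i≡n , i≡0)) with trans (sym 1+i≡n) (cong suc i≡0)
  next-irrefl (s≤s ()) (inj₂ _) | refl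

-- A set of edges, given as a symmetric relation M contained in adjacency,
-- such that every vertex lies on exactly one of them.
HasPerfectMatching : Graph V → Set₁
HasPerfectMatching {V} G =
  Σ[ M ∈ Rel V 0ℓ ] Symmetric M × (M ⇒ Adj G) × (∀ v → ∃! _≡_ (M v))

IsDominating : Graph (Fin k) → Subset k → Set
IsDominating G D = ∀ v → v ∉ D → ∃[ u ] u ∈ D × Adj G v u

IsPairedDominating : Graph (Fin k) → Subset k → Set₁
IsPairedDominating G D = IsDominating G D × HasPerfectMatching (induced G D)

-- "γₚ(G) = s".  At most one s satisfies this.  Classically, one exists exactly
-- when G has no isolated vertex, so that hypothesis is not repeated.
IsPairedDominationNumber : Graph (Fin k) → ℕ → Set₁
IsPairedDominationNumber G s =
  (∃[ D ] IsPairedDominating G D × ∣ D ∣ ≡ s) ×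
  (∀ D → IsPairedDominating G D → s ≤ ∣ D ∣)

{-# OPTIONS --safe #-}

-- Let c be the colouring of the columns of period 4 with values 1, 1, 0, 0, and
-- let D consist of the vertices (i , j) with i even and c (i + j) = 1. Each even
-- row is dominated from within, since every column has a neighbour of the other
-- colour; each odd row lies between two even rows (n being odd) which are
-- complementary. The columns 2k and 2k+1 have the same colour, so matching them
-- pairs up D. There are (n + 1) / 2 even rows, each with m / 2 vertices of D.
module Submission where

open import Defs
open import Data.Bool.Base using (Bool; true; false; not; _xor_)
open import Data.Bool.Properties using (not-involutive; not-¬; ¬-not) renaming (_≟_ to _≟ᵇ_)
open import Data.Fin.Base
  using (Fin; module Fin; zero; suc; toℕ; fromℕ; fromℕ<; inject₁; remQuot; combine; _↑ˡ_; _↑ʳ_; finToFun; funToFin)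
open import Data.Fin.Properties
  using (toℕ<n; toℕ-fromℕ; toℕ-fromℕ<; toℕ-inject₁; remQuot-combine; combine-remQuot;
         splitAt-↑ʳ; finToFun-funToFin; any?; all?)
  renaming (_≟_ to _≟ᶠ_)
open import Data.Fin.Subset using (Subset; _∈_; ∣_∣)
open import Data.Fin.Subset.Properties using (_∈?_; anySubset?)
open import Data.Nat using (ℕ; zero; suc; _+_; _*_; _≤_; _<_; _/_; _%_; _<?_)
  renaming (_≟_ to _≟ⁿ_)
open import Data.Nat.DivMod using (m≡m%n+[m/n]*n; m*n/n≡m)
open import Data.Nat.Induction using (<-wellFounded)
open import Data.Nat.Properties
  using (≤-trans; ≤-refl; ≤-reflexive; ≤-antisym; ≮⇒≥; <⇒≤; m≤m+n; *-assoc; suc-injective)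
open import Data.Nat.Tactic.RingSolver using (solve-∀)
open import Data.Product using (∃-syntax; _×_; _,_; proj₁; proj₂; map₁; map₂; uncurry)
open import Data.Sum.Base as Sum using (_⊎_; inj₁; inj₂)
open import Data.Vec.Base using (tabulate)
open import Data.Vec.Properties using (lookup∘tabulate; lookup⇒[]=; []=⇒lookup; tabulate-cong)
open import Data.Vec.Properties.WithK using ([]=-irrelevant)
open import Function.Base using (_∘_; _$_)
open import Induction.WellFounded using (Acc; acc)
open import Relation.Binary.Definitions using (Decidable)
open import Relation.Binary.PropositionalEquality
  using (_≡_; refl; sym; trans; cong; cong₂; subst; module ≡-Reasoning)
open import Relation.Nullary.Decidable using (Dec; yes; no; map′; ¬?; _×-dec_; _⊎-dec_; _→-dec_)
open import Relation.Nullary.Negation using (contradiction)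

private
  variable
    k l : ℕ

-- Existence of the paired domination number

-- A perfect matching as a partner function. Relations cannot be searched, whereas functions
-- `Fin k → Fin k` can be enumerated through finite codes.
IsMate : Graph (Fin k) → Subset k → (Fin k → Fin k) → Fin k → Set
IsMate G D f v = v ∈ D → f v ∈ D × Adj G v (f v) × f (f v) ≡ v

mates⇒matching : (G : Graph (Fin k)) (D : Subset k) (f : Fin k → Fin k) →
  (∀ v → IsMate G D f v) → HasPerfectMatching (induced G D)
mates⇒matching G D f mates =
  (λ (u , _) (v , _) → v ≡ f u) ,
  (λ { {u , u∈D} refl → sym (proj₂ (proj₂ (mates u u∈D))) }) ,
  (λ { {u , u∈D} refl → proj₁ (proj₂ (mates u u∈D)) }) ,
  λ (u , u∈D) → (f u , proj₁ (mates u u∈D)) , refl , λ { refl → cong (f u ,_) ([]=-irrelevant _ _) }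

matching⇒mates : (G : Graph (Fin k)) (D : Subset k) → HasPerfectMatching (induced G D) →
  ∃[ f ] ∀ v → IsMate G D f v
matching⇒mates G D (M , M-sym , M⇒Adj , M-unique) = f , mates
  where
  f : Fin _ → Fin _
  f v with v ∈? D
  ... | yes v∈D = proj₁ (proj₁ (M-unique (v , v∈D)))
  -- A default value: `IsMate` constrains `f` only on `D`.
  ... | no  _   = v

  f-partner : ∀ v (v∈D : v ∈ D) → f v ≡ proj₁ (proj₁ (M-unique (v , v∈D)))
  f-partner v v∈D with v ∈? D
  ... | yes v∈D′ = cong (λ p → proj₁ (proj₁ (M-unique (v , p)))) ([]=-irrelevant v∈D′ v∈D)
  ... | no  v∉D  = contradiction v∈D v∉D

  mates : ∀ v → IsMate G D f v
  mates v v∈D rewrite f-partner v v∈D with M-unique (v , v∈D)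
  ... | (w , w∈D) , Mvw , _ = w∈D , M⇒Adj Mvw ,
    -- By symmetry `M` relates `w` to `v`, so `v` is the unique partner of `w`.
    trans (f-partner w w∈D) (cong proj₁ (proj₂ (proj₂ (M-unique (w , w∈D))) (M-sym Mvw)))

-- Encoding and decoding returns a function only up to pointwise equality, along which the property
-- has to be transported.
IsMate-cong : (G : Graph (Fin k)) (D : Subset k) {f g : Fin k → Fin k} → (∀ v → f v ≡ g v) →
  ∀ v → IsMate G D f v → IsMate G D g v
IsMate-cong G D {f} {g} f≗g v mate v∈D with mate v∈D
... | fv∈D , adj , ffv≡v =
  subst (_∈ D) (f≗g v) fv∈D ,
  subst (Adj G v) (f≗g v) adj ,
  trans (sym (trans (f≗g (f v)) (cong g (f≗g v)))) ffv≡v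

module _ (G : Graph (Fin k)) (adj? : Decidable (Adj G)) where

  hasPerfectMatching? : ∀ D → Dec (HasPerfectMatching (induced G D))
  hasPerfectMatching? D = map′
    (λ (code , mates) → mates⇒matching G D (finToFun code) mates)
    (λ matching → let f , mates = matching⇒mates G D matching in
      funToFin f , λ v → IsMate-cong G D (sym ∘ finToFun-funToFin f) v (mates v))
    (any? λ code → let f = finToFun code in all? λ v →
      v ∈? D →-dec (f v ∈? D ×-dec adj? v (f v) ×-dec f (f v) ≟ᶠ v))

  isPairedDominating? : ∀ D → Dec (IsPairedDominating G D)
  isPairedDominating? D =
    (all? λ v → ¬? (v ∈? D) →-dec any? λ u → u ∈? D ×-dec adj? v u)
    ×-dec hasPerfectMatching? D

  -- An exact minimum has to be exhibited: starting from `D`, pass to a strictly smaller paired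
  -- dominating set as long as the finite search finds one.
  pairedDominationNumber≤ : ∀ D → IsPairedDominating G D →
    ∃[ γₚ ] IsPairedDominationNumber G γₚ × γₚ ≤ ∣ D ∣
  pairedDominationNumber≤ D = descend D (<-wellFounded ∣ D ∣)
    where
    descend : ∀ D → Acc _<_ ∣ D ∣ → IsPairedDominating G D →
      ∃[ γₚ ] IsPairedDominationNumber G γₚ × γₚ ≤ ∣ D ∣
    descend D (acc smaller) pd
      with anySubset? (λ D′ → isPairedDominating? D′ ×-dec ∣ D′ ∣ <? ∣ D ∣)
    ... | yes (D′ , pd′ , D′<D) = let γₚ , isγₚ , γₚ≤D′ = descend D′ (smaller D′<D) pd′ in
      γₚ , isγₚ , ≤-trans γₚ≤D′ (<⇒≤ D′<D)
    ... | no  none = ∣ D ∣ ,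
      ((D , pd , refl) , λ D′ pd′ → ≮⇒≥ λ D′<D → none (D′ , pd′ , D′<D)) , ≤-refl

-- Decidability of adjacency in the product of two cycles

next? : Decidable (Next {k})
next? {k} i j = toℕ j ≟ⁿ suc (toℕ i) ⊎-dec (suc (toℕ i) ≟ⁿ k ×-dec toℕ j ≟ⁿ 0)

cycle-adj? : (n : ℕ) (3≤n : 3 ≤ n) → Decidable (Adj (cycle n 3≤n))
cycle-adj? n 3≤n i j = next? i j ⊎-dec next? j i

□-adj? : (G : Graph (Fin k)) (H : Graph (Fin l)) →
  Decidable (Adj G) → Decidable (Adj H) → Decidable (Adj (G □ H))
□-adj? {l = l} G H adjG? adjH? u v =
  let a , b = remQuot l u ; c , d = remQuot l v in
  (a ≟ᶠ c ×-dec adjH? b d) ⊎-dec (adjG? a c ×-dec b ≟ᶠ d)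

-- Subsets of a product

grid : (Fin k → Fin l → Bool) → Subset (k * l)
grid {l = l} χ = tabulate (uncurry χ ∘ remQuot l)

∈-grid⁺ : (χ : Fin k → Fin l → Bool) (v : Fin (k * l)) →
  uncurry χ (remQuot l v) ≡ true → v ∈ grid χ
∈-grid⁺ χ v χv = lookup⇒[]= v _ (trans (lookup∘tabulate _ v) χv)

∈-grid⁻ : (χ : Fin k → Fin l → Bool) (v : Fin (k * l)) →
  v ∈ grid χ → uncurry χ (remQuot l v) ≡ true
∈-grid⁻ χ v v∈ = trans (sym (lookup∘tabulate _ v)) ([]=⇒lookup v∈)

∣tabulate∣-+ : ∀ k l (f : Fin (k + l) → Bool) →
  ∣ tabulate f ∣ ≡ ∣ tabulate (f ∘ (_↑ˡ l)) ∣ + ∣ tabulate (f ∘ (k ↑ʳ_)) ∣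
∣tabulate∣-+ zero    l f = refl
∣tabulate∣-+ (suc k) l f with f zero
... | true  = cong suc (∣tabulate∣-+ k l (f ∘ suc))
... | false = ∣tabulate∣-+ k l (f ∘ suc)

-- `remQuot` orders the vertices row by row, so the first `l` positions form row zero and the others
-- the grid of the remaining rows.
∣grid∣-suc : (χ : Fin (suc k) → Fin l → Bool) →
  ∣ grid χ ∣ ≡ ∣ tabulate (χ zero) ∣ + ∣ grid (χ ∘ suc) ∣
∣grid∣-suc {k} {l} χ = trans (∣tabulate∣-+ l (k * l) _) $ cong₂ _+_
  (cong ∣_∣ (tabulate-cong {n = l} λ j → cong (uncurry χ) (remQuot-combine {suc k} zero j)))
  (cong ∣_∣ (tabulate-cong {n = k * l} λ v → cong (uncurry χ) (remQuot-↑ʳ v)))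
  where
  remQuot-↑ʳ : ∀ v → remQuot {suc k} l (l ↑ʳ v) ≡ map₁ suc (remQuot {k} l v)
  remQuot-↑ʳ v rewrite splitAt-↑ʳ l (k * l) v = refl

∣tabulate-false∣ : ∀ k → ∣ tabulate {n = k} (λ _ → false) ∣ ≡ 0
∣tabulate-false∣ zero    = refl
∣tabulate-false∣ (suc k) = ∣tabulate-false∣ k

-- The dominating set

stripe : ℕ → Bool
stripe 0             = true
stripe 1             = true
stripe (suc (suc j)) = not (stripe j)

-- row i b tells whether row i of D meets a column of colour b.
row : ℕ → Bool → Bool
row 0             b = b
row 1             b = false
row (suc (suc i)) b = row i (not b)

-- The cases are `i` even and `i` odd, in the form that domination uses: in an even row, flipping
-- the colour flips membership; the rows on either side of an odd row are complementary.
row-parity : ∀ i → (∀ b → row i (not b) ≡ not (row i b)) ⊎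
  (∃[ h ] i ≡ suc h × ∀ b → row (suc i) b ≡ not (row h b))
row-parity 0 = inj₁ λ _ → refl
row-parity 1 = inj₂ (0 , refl , λ _ → refl)
row-parity (suc (suc i)) with row-parity i
... | inj₁ even           = inj₁ (even ∘ not)
... | inj₂ (h , refl , p) = inj₂ (suc (suc h) , refl , p ∘ not)

-- Used at the odd index `n`, to show that an odd row is never the last one.
row-odd-empty : ∀ p b → row (suc (p * 2)) b ≡ false
row-odd-empty zero    b = refl
row-odd-empty (suc p) b = row-odd-empty p (not b)

-- Cyclic neighbours and colourings of period 4

cyclic-suc : (i : Fin k) → ∃[ j ] Next i j
cyclic-suc {suc k} i with suc (toℕ i) <? suc k
... | yes 1+i<k = fromℕ< 1+i<k , inj₁ (toℕ-fromℕ< 1+i<k)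
... | no  1+i≮k = zero , inj₂ (≤-antisym (toℕ<n i) (≮⇒≥ 1+i≮k) , refl)

cyclic-pred : (i : Fin k) → ∃[ h ] Next h i
cyclic-pred {suc k} zero    = fromℕ k , inj₂ (cong suc (toℕ-fromℕ k) , refl)
cyclic-pred {suc k} (suc i) = inject₁ i , inj₁ (cong suc (sym (toℕ-inject₁ i)))

module _ {A : Set} (f : ℕ → A) (period : ∀ j → f (4 + j) ≡ f j) where

  periodic-0 : ∀ q → f (q * 2 * 2) ≡ f 0
  periodic-0 zero    = refl
  periodic-0 (suc q) = trans (period (q * 2 * 2)) (periodic-0 q)

  -- The period divides the length of the cycle, so its values do not see the seam between the last
  -- vertex and the first.
  periodic-Next : ∀ q {i j : Fin (q * 2 * 2)} → Next i j → f (toℕ j) ≡ f (suc (toℕ i))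
  periodic-Next q (inj₁ j≡1+i)         = cong f j≡1+i
  periodic-Next q (inj₂ (1+i≡m , j≡0)) =
    trans (cong f j≡0) (sym (trans (cong f 1+i≡m) (periodic-0 q)))

stripe-period : ∀ j → stripe (4 + j) ≡ stripe j
stripe-period j = not-involutive (stripe j)

-- The two neighbours of `j` are two steps apart and so have opposite colours; one of them differs
-- from `j`.
opposite-neighbour : ∀ q 3≤m (j : Fin (q * 2 * 2)) →
  ∃[ j′ ] Adj (cycle (q * 2 * 2) 3≤m) j j′ × stripe (toℕ j′) ≡ not (stripe (toℕ j))
opposite-neighbour q 3≤m j with cyclic-suc j | cyclic-pred j
... | s , j→s | h , h→j with stripe (toℕ s) ≟ᵇ not (stripe (toℕ j))
...   | yes opposite = s , inj₁ j→s , opposite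
...   | no  same     = h , inj₂ h→j , (begin
  stripe (toℕ h)              ≡⟨ not-involutive _ ⟨
  -- The shifted colouring `stripe ∘ suc` handles a seam between `h` and `j`; the next step handles
  -- one between `j` and `s`.
  not (stripe (2 + toℕ h))    ≡⟨ cong not (periodic-Next (stripe ∘ suc) (stripe-period ∘ suc) q h→j) ⟨
  not (stripe (1 + toℕ j))    ≡⟨ cong not (periodic-Next stripe stripe-period q j→s) ⟨
  not (stripe (toℕ s))        ≡⟨ cong not (¬-not same) ⟩
  not (not (not (stripe (toℕ j)))) ≡⟨ not-involutive _ ⟩
  not (stripe (toℕ j))        ∎)
  where open ≡-Reasoning

-- The pairing of columns

pairMate : ∀ p → Fin (p * 2) → Fin (p * 2)
pairMate (suc p) zero          = suc zero
pairMate (suc p) (suc zero)    = zero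
pairMate (suc p) (suc (suc j)) = suc (suc (pairMate p j))

pairMate-involutive : ∀ p j → pairMate p (pairMate p j) ≡ j
pairMate-involutive (suc p) zero          = refl
pairMate-involutive (suc p) (suc zero)    = refl
pairMate-involutive (suc p) (suc (suc j)) = cong (Fin.suc ∘ Fin.suc) (pairMate-involutive p j)

-- No pair straddles the seam, so the wrap-around case of `Next` does not arise.
pairMate-consecutive : ∀ p j →
  toℕ (pairMate p j) ≡ suc (toℕ j) ⊎ toℕ j ≡ suc (toℕ (pairMate p j))
pairMate-consecutive (suc p) zero          = inj₁ refl
pairMate-consecutive (suc p) (suc zero)    = inj₂ refl
pairMate-consecutive (suc p) (suc (suc j)) =
  Sum.map (cong (2 +_)) (cong (2 +_)) (pairMate-consecutive p j)

pairMate-stripe : ∀ p j → stripe (toℕ (pairMate p j)) ≡ stripe (toℕ j)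
pairMate-stripe (suc p) zero          = refl
pairMate-stripe (suc p) (suc zero)    = refl
pairMate-stripe (suc p) (suc (suc j)) = cong not (pairMate-stripe p j)

-- Counting the set

∣tabulate-stripe∣ : ∀ q (b : Bool) → ∣ tabulate {n = q * 2 * 2} (λ j → b xor stripe (toℕ j)) ∣ ≡ q * 2
∣tabulate-stripe∣ zero    b     = refl
∣tabulate-stripe∣ (suc q) true  = cong (2 +_) (trans
  (cong ∣_∣ (tabulate-cong {n = q * 2 * 2} λ j → cong not (stripe-period (toℕ j))))
  (∣tabulate-stripe∣ q true))
∣tabulate-stripe∣ (suc q) false = cong (2 +_) (trans
  (cong ∣_∣ (tabulate-cong {n = q * 2 * 2} λ j → stripe-period (toℕ j)))
  (∣tabulate-stripe∣ q false))

-- Dropping rows 0 and 1 replaces `c` by its complement, so the induction needs the sizes of both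
-- colour classes.
∣grid-row∣ : ∀ p {h} (c : Fin l → Bool) → ∣ tabulate c ∣ ≡ h → ∣ tabulate (not ∘ c) ∣ ≡ h →
  ∣ grid {suc (p * 2)} (λ i j → row (toℕ i) (c j)) ∣ ≡ suc p * h
∣grid-row∣ zero    c ∣c∣ ∣¬c∣ = trans (∣grid∣-suc {0} λ i j → row (toℕ i) (c j)) (cong (_+ 0) ∣c∣)
∣grid-row∣ {l} (suc p) {h} c ∣c∣ ∣¬c∣ = begin
  ∣ grid {3 + p * 2} χ ∣ ≡⟨ ∣grid∣-suc χ ⟩
  ∣ tabulate c ∣ + ∣ grid {2 + p * 2} (χ ∘ Fin.suc) ∣ ≡⟨ cong₂ _+_ ∣c∣ (∣grid∣-suc (χ ∘ Fin.suc)) ⟩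
  h + (∣ tabulate {n = l} (λ _ → false) ∣ + ∣ grid {suc (p * 2)} (χ ∘ Fin.suc ∘ Fin.suc) ∣)
    ≡⟨ cong (λ z → h + (z + ∣ grid {suc (p * 2)} (χ ∘ Fin.suc ∘ Fin.suc) ∣)) (∣tabulate-false∣ l) ⟩
  h + ∣ grid {suc (p * 2)} (χ ∘ Fin.suc ∘ Fin.suc) ∣
    ≡⟨ cong (h +_) (∣grid-row∣ p (not ∘ c) ∣¬c∣
         (trans (cong ∣_∣ (tabulate-cong (not-involutive ∘ c))) ∣c∣)) ⟩
  suc (suc p) * h ∎
  where
  open ≡-Reasoning
  χ : Fin (3 + p * 2) → Fin l → Bool
  χ i j = row (toℕ i) (c j)

-- The paired dominating set for `n = 2p + 1` and `m = 4q`

module _ (p q : ℕ) (3≤n : 3 ≤ suc (p * 2)) (3≤m : 3 ≤ q * 2 * 2) where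

  private
    n m : ℕ
    n = suc (p * 2)
    m = q * 2 * 2
    Cₙ = cycle n 3≤n
    Cₘ = cycle m 3≤m

  pattern-at : Fin n → Fin m → Bool
  pattern-at i j = row (toℕ i) (stripe (toℕ j))

  D : Subset (n * m)
  D = grid pattern-at

  ∣D∣ : ∣ D ∣ ≡ suc p * (q * 2)
  ∣D∣ = ∣grid-row∣ {l = m} p (stripe ∘ toℕ) (∣tabulate-stripe∣ q false) (∣tabulate-stripe∣ q true)

  dominating-neighbour : ∀ i j → pattern-at i j ≡ false →
    ∃[ i′ ] ∃[ j′ ] pattern-at i′ j′ ≡ true × Adj (cartesian Cₙ Cₘ) (i , j) (i′ , j′)
  dominating-neighbour i j ∉D with row-parity (toℕ i)
  ... | inj₁ even = let j′ , adj , opposite = opposite-neighbour q 3≤m j in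
    i , j′ , trans (cong (row (toℕ i)) opposite) (trans (even _) (cong not ∉D)) , inj₁ (refl , adj)
  -- In an odd row the neighbour is vertical: the row above decides which side it lies on.
  ... | inj₂ (h , i≡1+h , complementary) with row h (stripe (toℕ j)) in above | cyclic-pred i | cyclic-suc i
  ...   | true | g , inj₂ (_ , i≡0) | _ = contradiction (trans (sym i≡1+h) i≡0) λ ()
  ...   | true | g , g→i@(inj₁ i≡1+g) | _ = g , j ,
    trans (cong (λ x → row x (stripe (toℕ j))) (suc-injective (trans (sym i≡1+g) i≡1+h))) above ,
    inj₂ (inj₂ g→i , refl)
  ...   | false | _ | s , i→s@(inj₁ s≡1+i) = s , j ,
    trans (cong (λ x → row x (stripe (toℕ j))) s≡1+i) (trans (complementary _) (cong not above)) ,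
    inj₂ (inj₁ i→s , refl)
  -- Wrapping around would make `suc (toℕ i)` the odd index `n`, where `row` is empty, although it
  -- complements the value `false` above.
  ...   | false | _ | s , inj₂ (1+i≡n , _) = contradiction
    (trans (cong (λ x → row x (stripe (toℕ j))) 1+i≡n) (row-odd-empty p _))
    (not-¬ (trans (complementary _) (cong not above)))

  D-dominating : IsDominating (Cₙ □ Cₘ) D
  D-dominating v v∉D = combine i′ j′ ,
    ∈-grid⁺ pattern-at _ (trans (cong (uncurry pattern-at) (remQuot-combine i′ j′)) ∈D) ,
    subst (Adj (cartesian Cₙ Cₘ) (i , j)) (sym (remQuot-combine i′ j′)) adj
    where
    i = proj₁ (remQuot {n} m v)
    j = proj₂ (remQuot {n} m v)
    neighbour = dominating-neighbour i j (¬-not (v∉D ∘ ∈-grid⁺ pattern-at v))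
    i′ = proj₁ neighbour
    j′ = proj₁ (proj₂ neighbour)
    ∈D = proj₁ (proj₂ (proj₂ neighbour))
    adj = proj₂ (proj₂ (proj₂ neighbour))

  mate : Fin (n * m) → Fin (n * m)
  mate v = let i , j = remQuot {n} m v in combine i (pairMate (q * 2) j)

  remQuot-mate : ∀ v → remQuot {n} m (mate v) ≡ map₂ (pairMate (q * 2)) (remQuot {n} m v)
  remQuot-mate v = remQuot-combine {n} _ _

  D-mates : ∀ v → IsMate (Cₙ □ Cₘ) D mate v
  D-mates v v∈D =
    ∈-grid⁺ pattern-at _ (begin
      uncurry pattern-at (remQuot {n} m (mate v)) ≡⟨ cong (uncurry pattern-at) (remQuot-mate v) ⟩
      pattern-at i (pairMate (q * 2) j)               ≡⟨ cong (row (toℕ i)) (pairMate-stripe (q * 2) j) ⟩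
      pattern-at i j                          ≡⟨ ∈-grid⁻ pattern-at v v∈D ⟩
      true                                    ∎) ,
    subst (Adj (cartesian Cₙ Cₘ) (i , j)) (sym (remQuot-mate v))
      (inj₁ (refl , Sum.map inj₁ inj₁ (pairMate-consecutive (q * 2) j))) ,
    (begin
      mate (mate v)                     ≡⟨ cong (λ (a , b) → combine a (pairMate (q * 2) b)) (remQuot-mate v) ⟩
      combine i (pairMate (q * 2) (pairMate (q * 2) j)) ≡⟨ cong (combine i) (pairMate-involutive (q * 2) j) ⟩
      combine i j                       ≡⟨ combine-remQuot {n} m v ⟩
      v                                 ∎)
    where
    open ≡-Reasoning
    i = proj₁ (remQuot {n} m v)
    j = proj₂ (remQuot {n} m v)

  D-pairedDominating : IsPairedDominating (Cₙ □ Cₘ) D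
  D-pairedDominating = D-dominating , mates⇒matching (Cₙ □ Cₘ) D mate D-mates

  cycles-pairedDominationNumber≤ :
    ∃[ γₚ ] IsPairedDominationNumber (Cₙ □ Cₘ) γₚ × γₚ ≤ ((n + 1) * m) / 4
  cycles-pairedDominationNumber≤ =
    let γₚ , isγₚ , γₚ≤∣D∣ = pairedDominationNumber≤ (Cₙ □ Cₘ)
          (□-adj? Cₙ Cₘ (cycle-adj? n 3≤n) (cycle-adj? m 3≤m)) D D-pairedDominating
    in γₚ , isγₚ , ≤-trans γₚ≤∣D∣ (≤-reflexive (begin
      ∣ D ∣                       ≡⟨ ∣D∣ ⟩
      suc p * (q * 2)             ≡⟨ m*n/n≡m (suc p * (q * 2)) 4 ⟨
      -- The division is exact, as `(n + 1) * m` is four times the size of `D`.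
      (suc p * (q * 2)) * 4 / 4   ≡⟨ cong (_/ 4) (arith p q) ⟩
      ((n + 1) * m) / 4           ∎))
    where
    open ≡-Reasoning
    arith : ∀ p q → (suc p * (q * 2)) * 4 ≡ (suc (p * 2) + 1) * (q * 2 * 2)
    arith = solve-∀

theorem5p2 : (n m : ℕ) (5≤n : 5 ≤ n) (5≤m : 5 ≤ m) → m % 4 ≡ 0 → n % 4 ≡ 1 →
    ∃[ γₚ ] IsPairedDominationNumber (cycle n (≤-trans (m≤m+n 3 2) 5≤n) □ cycle m (≤-trans (m≤m+n 3 2) 5≤m)) γₚ
    × γₚ ≤ ((n + 1) * m) / 4
theorem5p2 n m 5≤n 5≤m m%4≡0 n%4≡1 = go (n / 4 * 2) (m / 4) n≡ m≡ 5≤n 5≤m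
  where
  n≡ : n ≡ suc (n / 4 * 2 * 2)
  n≡ = trans (m≡m%n+[m/n]*n n 4) (cong₂ _+_ n%4≡1 (sym (*-assoc (n / 4) 2 2)))

  m≡ : m ≡ m / 4 * 2 * 2
  m≡ = trans (m≡m%n+[m/n]*n m 4) (cong₂ _+_ m%4≡0 (sym (*-assoc (m / 4) 2 2)))

  -- Generalising `n` and `m` lets `refl` eliminate both equations, although the bounds occur inside
  -- the graphs.
  go : ∀ {n m} p q → n ≡ suc (p * 2) → m ≡ q * 2 * 2 → (5≤n : 5 ≤ n) (5≤m : 5 ≤ m) →
    ∃[ γₚ ] IsPairedDominationNumber (cycle n (≤-trans (m≤m+n 3 2) 5≤n) □ cycle m (≤-trans (m≤m+n 3 2) 5≤m)) γₚ
    × γₚ ≤ ((n + 1) * m) / 4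
  go p q refl refl 5≤n 5≤m =
    cycles-pairedDominationNumber≤ p q (≤-trans (m≤m+n 3 2) 5≤n) (≤-trans (m≤m+n 3 2) 5≤m)
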